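{- For every $\varepsilon\in(0,1)$, there is a polynomial-time (iterative greedy) $(1-\varepsilon,\lceil\log_2\varepsilon^{ -1}\rceil)$-bicriteria approximation algorithm for the problem of maximizing a non-negative monotone submodular function subject to a matroid constraint.
   Context: $f\colon2^{\mathcal N}\to\mathbb R_{\ge0}$ is submodular if $f(S\cup\{u\})-f(S)\ge f(T\cup\{u\})-f(T)$ for all $S\subseteq T\subseteq\mathcal N$, $u\notin T$; monotone if $S\subseteq T\Rightarrow f(S)\le f(T)$; accessed via a value oracle (and the matroid via an independence oracle). For a matroid $\mathcal M=(\mathcal N,\mathcal I)$, the feasible sets are the independent sets and the matroid polytope $\mathcal P$ is the convex hull of $\{\mathbf 1_S: S\in\mathcal I\}$. With $OPT$ an independent set maximizing $f$, an $(\alpha,\beta)$-bicriteria approximation algorithm outputs $S$ with $f(S)\ge\alpha f(OPT)$ and $\mathbf 1_S/\beta\in\mathcal P$. -}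

module Defs where

open import Level using (Level; _⊔_; 0ℓ) renaming (suc to lsuc)
open import Algebra.Bundles using (CommutativeRing; Semiring)
open import Data.Bool.Base using (Bool; true; false; not; if_then_else_)
open import Data.Fin.Base using (Fin)
open import Data.Fin.Subset
  using (Subset; ⊥; ⁅_⁆; _∪_; _∈_; _∉_; _⊆_; ∣_∣; inside; outside)
open import Data.Nat.Base as ℕ using (ℕ; zero; suc)
open import Data.Product.Base using (Σ-syntax; ∃; ∃-syntax; _×_)
open import Data.Vec.Base using ([]; _∷_; lookup)
open import Data.Vec.Functional using (Vector)
open import Function.Bundles using (_⇔_)
open import Relation.Binary.Core using (Rel)
open import Relation.Binary.Structures using (IsDecTotalOrder)
open import Relation.Binary.PropositionalEquality using (_≡_)
open import Relation.Nullary using (¬_)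
open import Relation.Nullary.Decidable using (⌊_⌋)
open import Relation.Unary using (Pred; Decidable)
import Algebra.Definitions.RawSemiring as RawSemiringDefinitions
import Relation.Binary.Construct.NonStrictToStrict as ToStrict

------------------------------------------------------------------------
-- The real numbers

-- Classically, the Dedekind-complete totally ordered fields are exactly the
-- copies of ℝ.  Comparison is decidable, as it is for classical reals.

record RealNumbers (c ℓ : Level) : Set (lsuc (c ⊔ ℓ)) where
  field
    commutativeRing : CommutativeRing c ℓ

  open CommutativeRing commutativeRing public

  infix 4 _≤_
  infix 9 _⁻¹

  field
    _≤_             : Rel Carrier ℓ
    isDecTotalOrder : IsDecTotalOrder _≈_ _≤_
    +-monoʳ-≤       : ∀ x {y z} → y ≤ z → x + y ≤ x + z
    *-nonNegative   : ∀ {x y} → 0# ≤ x → 0# ≤ y → 0# ≤ x * y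
    0≉1             : ¬ (0# ≈ 1#)
    -- The inverse is a total function; 0# ⁻¹ is an unspecified element.
    _⁻¹             : Carrier → Carrier
    ⁻¹-cong         : ∀ {x y} → x ≈ y → x ⁻¹ ≈ y ⁻¹
    *-inverseʳ      : ∀ {x} → ¬ (x ≈ 0#) → x * x ⁻¹ ≈ 1#

  UpperBound : Pred Carrier (c ⊔ ℓ) → Pred Carrier (c ⊔ ℓ)
  UpperBound P b = ∀ x → P x → x ≤ b

  field
    supremum : (P : Pred Carrier (c ⊔ ℓ)) → ∃ P → ∃ (UpperBound P) →
               ∃[ s ] UpperBound P s × (∀ b → UpperBound P b → s ≤ b)

  open IsDecTotalOrder isDecTotalOrder public using (_≟_; _≤?_)
  open ToStrict _≈_ _≤_ public using (_<_)
  open RawSemiringDefinitions (Semiring.rawSemiring semiring) public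
    using (sum; _^_) renaming (_×_ to _·_)

  fromℕ : ℕ → Carrier
  fromℕ n = n · 1#

  -- y = log₂ x for x > 0, by comparing y with every rational (m - n) / q:
  -- y ≤ (m - n) / q exactly when x ≤ 2 ^ ((m - n) / q), i.e. when
  -- x ^ q * 2 ^ n ≤ 2 ^ m.
  IsLog₂ : Carrier → Carrier → Set ℓ
  IsLog₂ x y = ∀ m n q → 0 ℕ.< q →
    (fromℕ q * y + fromℕ n ≤ fromℕ m) ⇔ (x ^ q * fromℕ 2 ^ n ≤ fromℕ 2 ^ m)

  IsCeiling : Carrier → ℕ → Set ℓ
  IsCeiling y k = y ≤ fromℕ k × fromℕ k < y + 1#

------------------------------------------------------------------------
-- Matroids on the ground set Fin n

record Matroid (n : ℕ) : Set₁ where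
  field
    Independent  : Pred (Subset n) 0ℓ
    independent? : Decidable Independent
    ⊥-indep      : Independent ⊥
    hereditary   : ∀ {A B} → A ⊆ B → Independent B → Independent A
    augmentation : ∀ {A B} → Independent A → Independent B → ∣ A ∣ ℕ.< ∣ B ∣ →
                   ∃[ u ] u ∈ B × u ∉ A × Independent (A ∪ ⁅ u ⁆)

------------------------------------------------------------------------
-- A programming language for oracle algorithms

-- Programs have registers of three sorts, each named by natural numbers:
-- counters holding naturals, value registers holding reals, and set registers
-- holding subsets of the ground set as bit arrays.  The model is uniform: a
-- program is a finite piece of syntax that mentions no instance and no real
-- constant.  Counters only grow by increments and reals can only be obtained
-- from the value oracle and combined by + and -, so unit cost per instruction
-- hides no more than a polynomial amount of work.

Var : Set
Var = ℕ

data Instruction : Set where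
  zero-ctr   : Var → Instruction
  inc-ctr    : Var → Instruction
  copy-ctr   : Var → Var → Instruction
  size       : Var → Instruction         -- the number of elements
  query      : Var → Var → Instruction   -- real ≔ f (set)
  copy-val   : Var → Var → Instruction
  add-val    : Var → Var → Var → Instruction
  sub-val    : Var → Var → Var → Instruction
  clear-set  : Var → Instruction
  insert     : Var → Var → Instruction   -- set ≔ set ∪ { counter }
  remove     : Var → Var → Instruction   -- set ≔ set ∖ { counter }

data Test : Set where
  lt-ctr : Var → Var → Test
  le-val : Var → Var → Test
  member : Var → Var → Test              -- counter ∈ set
  indep  : Var → Test                    -- independence oracle
  neg    : Test → Test

infixr 5 _⨾_

data Program : Set where
  skip    : Program
  exec    : Instruction → Program
  _⨾_     : Program → Program → Program
  ifte    : Test → Program → Program → Program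
  while   : Test → Program → Program

infix 8 _[_↦_]

_[_↦_] : ∀ {a} {A : Set a} → (Var → A) → Var → A → (Var → A)
(g [ x ↦ v ]) y = if x ℕ.≡ᵇ y then v else g y

-- Positions outside the bit array read as false and ignore writes.

getBit : ∀ {n} → ℕ → Subset n → Bool
getBit _       []      = false
getBit zero    (b ∷ _) = b
getBit (suc i) (_ ∷ S) = getBit i S

setBit : ∀ {n} → Bool → ℕ → Subset n → Subset n
setBit _ _       []      = []
setBit b zero    (_ ∷ S) = b ∷ S
setBit b (suc i) (a ∷ S) = a ∷ setBit b i S

module _ {c ℓ} (ℛ : RealNumbers c ℓ) where
  open RealNumbers ℛ

  ----------------------------------------------------------------------
  -- Instances: monotone submodular maximization subject to a matroid

  NonNegative : ∀ {n} → (Subset n → Carrier) → Set ℓ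
  NonNegative f = ∀ S → 0# ≤ f S

  Monotone : ∀ {n} → (Subset n → Carrier) → Set ℓ
  Monotone f = ∀ S T → S ⊆ T → f S ≤ f T

  Submodular : ∀ {n} → (Subset n → Carrier) → Set ℓ
  Submodular f = ∀ S T u → S ⊆ T → u ∉ T →
    f (T ∪ ⁅ u ⁆) - f T ≤ f (S ∪ ⁅ u ⁆) - f S

  record Instance : Set (lsuc 0ℓ ⊔ c ⊔ ℓ) where
    field
      n           : ℕ
      f           : Subset n → Carrier
      nonNegative : NonNegative f
      monotone    : Monotone f
      submodular  : Submodular f
      matroid     : Matroid n

    open Matroid matroid public

  ----------------------------------------------------------------------
  -- The matroid polytope

  ConvexHull : ∀ {n p} → Pred (Vector Carrier n) p → Pred (Vector Carrier n) (c ⊔ ℓ ⊔ p)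
  ConvexHull {n} X x =
    ∃[ k ] Σ[ w ∈ Vector Carrier k ] Σ[ v ∈ Vector (Vector Carrier n) k ]
      (∀ i → 0# ≤ w i) × sum w ≈ 1# × (∀ i → X (v i)) ×
      (∀ e → x e ≈ sum (λ i → w i * v i e))

  𝟏 : ∀ {n} → Subset n → Vector Carrier n
  𝟏 S e = if lookup S e then 1# else 0#

  MatroidPolytope : ∀ {n} → Matroid n → Pred (Vector Carrier n) (c ⊔ ℓ)
  MatroidPolytope M =
    ConvexHull (λ x → ∃[ S ] Matroid.Independent M S × (∀ e → x e ≈ 𝟏 S e))

  ----------------------------------------------------------------------
  -- Execution of programs

  record State (n : ℕ) : Set c where
    field
      ctr : Var → ℕ
      val : Var → Carrier
      set : Var → Subset n

  module _ (I : Instance) where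
    open Instance I
    open State

    initial : State n
    initial = record { ctr = λ _ → 0 ; val = λ _ → 0# ; set = λ _ → ⊥ }

    execute : Instruction → State n → State n
    execute (zero-ctr x)    σ = record σ { ctr = ctr σ [ x ↦ 0 ] }
    execute (inc-ctr x)     σ = record σ { ctr = ctr σ [ x ↦ suc (ctr σ x) ] }
    execute (copy-ctr x y)  σ = record σ { ctr = ctr σ [ x ↦ ctr σ y ] }
    execute (size x)        σ = record σ { ctr = ctr σ [ x ↦ n ] }
    execute (query r s)     σ = record σ { val = val σ [ r ↦ f (set σ s) ] }
    execute (copy-val r q)  σ = record σ { val = val σ [ r ↦ val σ q ] }
    execute (add-val r p q) σ = record σ { val = val σ [ r ↦ val σ p + val σ q ] }
    execute (sub-val r p q) σ = record σ { val = val σ [ r ↦ val σ p - val σ q ] }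
    execute (clear-set s)   σ = record σ { set = set σ [ s ↦ ⊥ ] }
    execute (insert s x)    σ = record σ { set = set σ [ s ↦ setBit inside (ctr σ x) (set σ s) ] }
    execute (remove s x)    σ = record σ { set = set σ [ s ↦ setBit outside (ctr σ x) (set σ s) ] }

    evaluate : Test → State n → Bool
    evaluate (lt-ctr x y) σ = ctr σ x ℕ.<ᵇ ctr σ y
    evaluate (le-val p q) σ = ⌊ val σ p ≤? val σ q ⌋
    evaluate (member x s) σ = getBit (ctr σ x) (set σ s)
    evaluate (indep s)    σ = ⌊ independent? (set σ s) ⌋
    evaluate (neg b)      σ = not (evaluate b σ)

    infix 4 ⟨_,_⟩⇓[_]_

    -- ⟨ P , σ ⟩⇓[ t ] τ: started in σ, P halts in τ after t steps, where every
    -- instruction and every test evaluation is a step.  The rules are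
    -- deterministic.
    data ⟨_,_⟩⇓[_]_ : Program → State n → ℕ → State n → Set c where
      skip : ∀ {σ} → ⟨ skip , σ ⟩⇓[ 0 ] σ
      exec : ∀ {i σ} → ⟨ exec i , σ ⟩⇓[ 1 ] execute i σ
      _⨾_  : ∀ {P Q σ σ′ σ″ s t} →
             ⟨ P , σ ⟩⇓[ s ] σ′ → ⟨ Q , σ′ ⟩⇓[ t ] σ″ →
             ⟨ P ⨾ Q , σ ⟩⇓[ s ℕ.+ t ] σ″
      if-true  : ∀ {b P Q σ σ′ t} → evaluate b σ ≡ true →
             ⟨ P , σ ⟩⇓[ t ] σ′ → ⟨ ifte b P Q , σ ⟩⇓[ suc t ] σ′
      if-false : ∀ {b P Q σ σ′ t} → evaluate b σ ≡ false →
             ⟨ Q , σ ⟩⇓[ t ] σ′ → ⟨ ifte b P Q , σ ⟩⇓[ suc t ] σ′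
      while-true  : ∀ {b P σ σ′ σ″ s t} → evaluate b σ ≡ true →
             ⟨ P , σ ⟩⇓[ s ] σ′ → ⟨ while b P , σ′ ⟩⇓[ t ] σ″ →
             ⟨ while b P , σ ⟩⇓[ suc (s ℕ.+ t) ] σ″
      while-false : ∀ {b P σ} → evaluate b σ ≡ false →
             ⟨ while b P , σ ⟩⇓[ 1 ] σ

    -- The output is the content of set register 0.
    HaltsWith : Program → ℕ → Subset n → Set c
    HaltsWith P t S = ∃[ τ ] (⟨ P , initial ⟩⇓[ t ] τ) × set τ 0 ≡ S

    --------------------------------------------------------------------
    -- Solutions

    IsOptimal : Subset n → Set ℓ
    IsOptimal S = Independent S × (∀ T → Independent T → f T ≤ f S)

    IsBicriteriaApproximation : Carrier → Carrier → Subset n → Set (c ⊔ ℓ)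
    IsBicriteriaApproximation α β S =
      (∀ OPT → IsOptimal OPT → α * f OPT ≤ f S) ×
      MatroidPolytope matroid (λ e → 𝟏 S e * β ⁻¹)

    -- Sets reachable by the greedy algorithm run on the objective g.
    data GreedyRun (g : Subset n → Carrier) : Subset n → Set ℓ where
      start  : GreedyRun g ⊥
      extend : ∀ {A} u → GreedyRun g A → u ∉ A → Independent (A ∪ ⁅ u ⁆) →
               (∀ v → v ∉ A → Independent (A ∪ ⁅ v ⁆) → g (A ∪ ⁅ v ⁆) ≤ g (A ∪ ⁅ u ⁆)) →
               GreedyRun g (A ∪ ⁅ u ⁆)

    GreedyOutput : (Subset n → Carrier) → Subset n → Set ℓ
    GreedyOutput g A = GreedyRun g A × (∀ v → v ∉ A → ¬ Independent (A ∪ ⁅ v ⁆))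

    -- Each round runs greedy on the marginal objective f(· ∣ S), where S is the
    -- union of the outputs of the previous rounds.
    data IterativeGreedyOutput : ℕ → Subset n → Set (c ⊔ ℓ) where
      done  : IterativeGreedyOutput 0 ⊥
      round : ∀ {k S A} → IterativeGreedyOutput k S →
              GreedyOutput (λ B → f (S ∪ B) - f S) A →
              IterativeGreedyOutput (suc k) (S ∪ A)

  ----------------------------------------------------------------------
  -- Algorithms

  PolynomialTime : Program → Set (lsuc 0ℓ ⊔ c ⊔ ℓ)
  PolynomialTime P = ∃[ a ] ∃[ d ] ∀ (I : Instance) →
    ∃[ t ] ∃[ S ] HaltsWith I P t S × t ℕ.≤ a ℕ.* suc (Instance.n I) ℕ.^ d

  BicriteriaApproximationAlgorithm : Carrier → Carrier → Program → Set (lsuc 0ℓ ⊔ c ⊔ ℓ)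
  BicriteriaApproximationAlgorithm α β P = ∀ (I : Instance) →
    ∃[ t ] ∃[ S ] HaltsWith I P t S × IsBicriteriaApproximation I α β S

  IterativeGreedyAlgorithm : ℕ → Program → Set (lsuc 0ℓ ⊔ c ⊔ ℓ)
  IterativeGreedyAlgorithm k P = ∀ (I : Instance) →
    ∃[ t ] ∃[ S ] HaltsWith I P t S × IterativeGreedyOutput I k S

{-# OPTIONS --safe #-}
module Submission where

-- Run greedily on h = f(S ∪ ·), a greedy set A satisfies h(A ∪ O) + h(∅) ≤ 2 h(A)
-- for every independent O with |O| ≤ |A|; as A ends up as a base, one round
-- halves the gap f(OPT) - f(S).  After k rounds the gap is at most
-- 2⁻ᵏ f(OPT) ≤ ε f(OPT).  Removing from each round's output the elements found
-- earlier partitions the final set into k independent sets, so 𝟏_S / k is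
-- their average and lies in the matroid polytope.

open import Defs
open import Level using (Level; _⊔_)
open import Data.Bool.Base using (true; false)
import Data.Fin.Properties as Fin
open import Data.Fin.Base using (Fin; zero; suc; toℕ; fromℕ<)
open import Data.Fin.Subset
  using (Subset; ⊥; ⁅_⁆; _∪_; _─_; _∈_; _∉_; _⊆_; ∣_∣; inside; outside)
  renaming (_-_ to _∖_)
open import Data.Fin.Subset.Properties
open import Data.Nat.Base as ℕ using (ℕ; zero; suc; z≤n; s≤s)
import Data.Nat.Properties as ℕₚ
open import Data.Nat.Solver using () renaming (module +-*-Solver to ℕSolver)
open import Data.Product.Base using (∃-syntax; _×_; _,_; proj₁; proj₂)
open import Data.Sum.Base using (_⊎_; inj₁; inj₂; [_,_]′)
open import Data.Vec.Base using ([]; _∷_; lookup; here; there)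
import Data.Vec.Functional as Vector
open import Data.Vec.Properties using ([]=⇒lookup; lookup⇒[]=)
open import Function.Base using (_∘_; id)
open import Function.Bundles using (Equivalence)
open import Relation.Binary.Bundles using (DecTotalOrder)
open import Relation.Binary.PropositionalEquality as ≡ using (_≡_; refl; cong; cong₂; subst)
open import Relation.Binary.Structures using (IsDecTotalOrder)
open import Relation.Nullary using (Dec; ¬_; yes; no; contradiction)
open import Relation.Nullary.Decidable using (⌊_⌋; dec-true; dec-false)
import Algebra.Properties.Semiring.Mult as SemiringMult
import Algebra.Properties.Semiring.Sum as SemiringSum
import Algebra.Properties.Ring as RingProperties
import Algebra.Solver.IdempotentCommutativeMonoid as ICMSolver
import Algebra.Solver.Ring.NaturalCoefficients.Default as SemiringSolver
import Relation.Binary.Reasoning.PartialOrder as PosetReasoning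
import Relation.Binary.Reasoning.Setoid as SetoidReasoning

-- Consequences of the ordered field axioms.

module RealProperties {c ℓ} (ℛ : RealNumbers c ℓ) where
  open RealNumbers ℛ renaming (refl to ≈-refl; sym to ≈-sym; trans to ≈-trans)
  open IsDecTotalOrder isDecTotalOrder public
    using (total; antisym) renaming (refl to ≤-refl; trans to ≤-trans; reflexive to ≤-reflexive)
  open RingProperties ring using (-‿distribˡ-*; -‿involutive)
  open SemiringSolver commutativeSemiring using (solve; _:+_; _:*_; _:=_; con)

  ≤-poset = DecTotalOrder.poset (record { isDecTotalOrder = isDecTotalOrder })
  module ≤-Reasoning = PosetReasoning ≤-poset

  +-mono-≤ : ∀ {x y z w} → x ≤ y → z ≤ w → x + z ≤ y + w
  +-mono-≤ {x} {y} {z} {w} x≤y z≤w = begin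
    x + z ≤⟨ +-monoʳ-≤ x z≤w ⟩
    x + w ≈⟨ +-comm x w ⟩
    w + x ≤⟨ +-monoʳ-≤ w x≤y ⟩
    w + y ≈⟨ +-comm w y ⟩
    y + w ∎
    where open ≤-Reasoning

  +-cancelˡ-≤ : ∀ x {y z} → x + y ≤ x + z → y ≤ z
  +-cancelˡ-≤ x {y} {z} x+y≤x+z = begin
    y               ≈⟨ cancel y ⟨
    - x + (x + y)   ≤⟨ +-monoʳ-≤ (- x) x+y≤x+z ⟩
    - x + (x + z)   ≈⟨ cancel z ⟩
    z               ∎
    where
    open ≤-Reasoning
    cancel : ∀ y → - x + (x + y) ≈ y
    cancel y = ≈-trans (≈-sym (+-assoc (- x) x y))
      (≈-trans (+-congʳ (-‿inverseˡ x)) (+-identityˡ y))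

  -≤-⇒+≤+ : ∀ {a b x y} → a - b ≤ x - y → a + y ≤ x + b
  -≤-⇒+≤+ {a} {b} {x} {y} a-b≤x-y = begin
    a + y               ≈⟨ restore a b y ⟨
    (a - b) + (b + y)   ≤⟨ +-mono-≤ a-b≤x-y ≤-refl ⟩
    (x - y) + (b + y)   ≈⟨ +-congˡ (+-comm b y) ⟩
    (x - y) + (y + b)   ≈⟨ restore x y b ⟩
    x + b               ∎
    where
    open ≤-Reasoning
    restore : ∀ a b y → (a - b) + (b + y) ≈ a + y
    restore a b y = ≈-trans
      (solve 4 (λ a nb b y → (a :+ nb) :+ (b :+ y) := (a :+ y) :+ (b :+ nb)) ≈-refl a (- b) b y)
      (≈-trans (+-congˡ (-‿inverseʳ b)) (+-identityʳ _))

  -- Splitting off a common summand z reduces linear arithmetic to a semiring identity.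
  ≤-from-sum : ∀ {a b x y} z → z + x ≈ a → b ≈ z + y → a ≤ b → x ≤ y
  ≤-from-sum z z+x≈a b≈z+y a≤b =
    +-cancelˡ-≤ z (≤-trans (≤-reflexive z+x≈a) (≤-trans a≤b (≤-reflexive b≈z+y)))

  *-monoˡ-≤ : ∀ {x y z} → 0# ≤ x → y ≤ z → x * y ≤ x * z
  *-monoˡ-≤ {x} {y} {z} 0≤x y≤z = begin
    x * y                 ≈⟨ +-identityʳ _ ⟨
    x * y + 0#            ≤⟨ +-monoʳ-≤ (x * y) (*-nonNegative 0≤x 0≤z-y) ⟩
    x * y + x * (z - y)   ≈⟨ distribˡ x y (z - y) ⟨
    x * (y + (z - y))     ≈⟨ *-congˡ (solve 3 (λ y z ny → y :+ (z :+ ny) := z :+ (y :+ ny)) ≈-refl y z (- y)) ⟩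
    x * (z + (y - y))     ≈⟨ *-congˡ (+-congˡ (-‿inverseʳ y)) ⟩
    x * (z + 0#)          ≈⟨ *-congˡ (+-identityʳ z) ⟩
    x * z                 ∎
    where
    open ≤-Reasoning
    0≤z-y : 0# ≤ z - y
    0≤z-y = begin
      0#      ≈⟨ -‿inverseʳ y ⟨
      y - y   ≤⟨ +-mono-≤ y≤z ≤-refl ⟩
      z - y   ∎

  x≤0⇒0≤-x : ∀ {x} → x ≤ 0# → 0# ≤ - x
  x≤0⇒0≤-x {x} x≤0 = +-cancelˡ-≤ x (begin
    x + 0#    ≈⟨ +-identityʳ x ⟩
    x         ≤⟨ x≤0 ⟩
    0#        ≈⟨ -‿inverseʳ x ⟨
    x - x     ∎)
    where open ≤-Reasoning

  0≤1 : 0# ≤ 1#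
  0≤1 with total 0# 1#
  ... | inj₁ 0≤1 = 0≤1
  -- If 1 ≤ 0 then -1 is non-negative, and so is its square 1.
  ... | inj₂ 1≤0 = begin
    0#            ≤⟨ *-nonNegative (x≤0⇒0≤-x 1≤0) (x≤0⇒0≤-x 1≤0) ⟩
    - 1# * - 1#   ≈⟨ -‿distribˡ-* 1# (- 1#) ⟨
    - (1# * - 1#) ≈⟨ -‿cong (*-identityˡ (- 1#)) ⟩
    - - 1#        ≈⟨ -‿involutive 1# ⟩
    1#            ∎
    where open ≤-Reasoning

  ⁻¹-nonNegative : ∀ {x} → 0# ≤ x → ¬ (x ≈ 0#) → 0# ≤ x ⁻¹
  ⁻¹-nonNegative {x} 0≤x x≉0 with total 0# (x ⁻¹)
  ... | inj₁ 0≤x⁻¹ = 0≤x⁻¹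
  ... | inj₂ x⁻¹≤0 = contradiction (antisym 0≤1 1≤0) 0≉1
    where
    open ≤-Reasoning
    1≤0 : 1# ≤ 0#
    1≤0 = begin
      1#          ≈⟨ *-inverseʳ x≉0 ⟨
      x * x ⁻¹    ≤⟨ *-monoˡ-≤ 0≤x x⁻¹≤0 ⟩
      x * 0#      ≈⟨ zeroʳ x ⟩
      0#          ∎

  *-cancelˡ-≤ : ∀ {x y z} → 0# ≤ x → ¬ (x ≈ 0#) → x * y ≤ x * z → y ≤ z
  *-cancelˡ-≤ {x} {y} {z} 0≤x x≉0 xy≤xz = begin
    y                 ≈⟨ cancel y ⟨
    x ⁻¹ * (x * y)    ≤⟨ *-monoˡ-≤ (⁻¹-nonNegative 0≤x x≉0) xy≤xz ⟩
    x ⁻¹ * (x * z)    ≈⟨ cancel z ⟩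
    z                 ∎
    where
    open ≤-Reasoning
    cancel : ∀ y → x ⁻¹ * (x * y) ≈ y
    cancel y = ≈-trans (solve 3 (λ i x y → i :* (x :* y) := (x :* i) :* y) ≈-refl (x ⁻¹) x y)
      (≈-trans (*-congʳ (*-inverseʳ x≉0)) (*-identityˡ y))

  fromℕ-nonNegative : ∀ n → 0# ≤ fromℕ n
  fromℕ-nonNegative zero    = ≤-refl
  fromℕ-nonNegative (suc n) = begin
    0#              ≈⟨ +-identityˡ 0# ⟨
    0# + 0#         ≤⟨ +-mono-≤ 0≤1 (fromℕ-nonNegative n) ⟩
    1# + fromℕ n    ∎
    where open ≤-Reasoning

  1≤fromℕ-suc : ∀ n → 1# ≤ fromℕ (suc n)
  1≤fromℕ-suc n = begin
    1#              ≈⟨ +-identityʳ 1# ⟨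
    1# + 0#         ≤⟨ +-monoʳ-≤ 1# (fromℕ-nonNegative n) ⟩
    1# + fromℕ n    ∎
    where open ≤-Reasoning

  1≤⇒≉0 : ∀ {x} → 1# ≤ x → ¬ (x ≈ 0#)
  1≤⇒≉0 1≤x x≈0 = 0≉1 (antisym 0≤1 (≤-trans 1≤x (≤-reflexive x≈0)))

  1≤2^ : ∀ k → 1# ≤ fromℕ 2 ^ k
  1≤2^ zero    = ≤-refl
  1≤2^ (suc k) = begin
    1#                      ≤⟨ 1≤2^ k ⟩
    fromℕ 2 ^ k             ≈⟨ *-identityʳ _ ⟨
    fromℕ 2 ^ k * 1#        ≤⟨ *-monoˡ-≤ (≤-trans 0≤1 (1≤2^ k)) (1≤fromℕ-suc 1) ⟩
    fromℕ 2 ^ k * fromℕ 2   ≈⟨ *-comm _ _ ⟩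
    fromℕ 2 ^ suc k         ∎
    where open ≤-Reasoning

  2^-suc-* : ∀ k x → fromℕ 2 ^ suc k * x ≈ fromℕ 2 ^ k * (x + x)
  2^-suc-* k x = solve 2 (λ p x → ((con 1 :+ (con 1 :+ con 0)) :* p) :* x := p :* (x :+ x)) ≈-refl (fromℕ 2 ^ k) x

  -- Comparing `y` with the rational (k - 0) / 1 in `IsLog₂` gives exactly this.
  log₂≤⇒≤2^ : ∀ {x y} k → IsLog₂ x y → y ≤ fromℕ k → x ≤ fromℕ 2 ^ k
  log₂≤⇒≤2^ {x} {y} k log y≤k = begin
    x               ≈⟨ solve 1 (λ x → x := (x :* con 1) :* con 1) ≈-refl x ⟩
    (x * 1#) * 1#   ≤⟨ Equivalence.to (log k 0 1 (s≤s z≤n)) k*1 ⟩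
    fromℕ 2 ^ k     ∎
    where
    open ≤-Reasoning
    k*1 : fromℕ 1 * y + fromℕ 0 ≤ fromℕ k
    k*1 = begin
      (1# + 0#) * y + 0#  ≈⟨ solve 1 (λ y → (con 1 :+ con 0) :* y :+ con 0 := y) ≈-refl y ⟩
      y                   ≤⟨ y≤k ⟩
      fromℕ k             ∎

  -- Turns a gap of 2⁻ᵏ a into the ratio 1 - ε. With p = 2ᵏ, the hypothesis on `ε` gives 1 ≤ εp, so
  -- the additive `a` is at most p ε a; moving this term to the left and dividing by p leaves the
  -- claim.
  geometric-decay : ∀ {ε a b} k → 0# < ε → ε ⁻¹ ≤ fromℕ 2 ^ k → 0# ≤ a →
    fromℕ 2 ^ k * a ≤ fromℕ 2 ^ k * b + a → (1# - ε) * a ≤ b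
  geometric-decay {ε} {a} {b} k (0≤ε , 0≉ε) ε⁻¹≤p 0≤a pa≤pb+a =
    *-cancelˡ-≤ (≤-trans 0≤1 (1≤2^ k)) (1≤⇒≉0 (1≤2^ k))
      (≤-from-sum (p * ε * a) split ≈-refl (≤-trans pa≤pb+a
        (≤-trans (+-monoʳ-≤ (p * b) a≤pεa) (≤-reflexive (+-comm _ _)))))
    where
    open ≤-Reasoning
    p = fromℕ 2 ^ k
    1≤pε : 1# ≤ ε * p
    1≤pε = begin
      1#        ≈⟨ *-inverseʳ (0≉ε ∘ ≈-sym) ⟨
      ε * ε ⁻¹  ≤⟨ *-monoˡ-≤ 0≤ε ε⁻¹≤p ⟩
      ε * p     ∎
    a≤pεa : a ≤ p * ε * a
    a≤pεa = begin
      a             ≈⟨ *-identityʳ a ⟨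
      a * 1#        ≤⟨ *-monoˡ-≤ 0≤a 1≤pε ⟩
      a * (ε * p)   ≈⟨ solve 3 (λ a ε p → a :* (ε :* p) := p :* ε :* a) ≈-refl a ε p ⟩
      p * ε * a     ∎
    split : p * ε * a + p * ((1# - ε) * a) ≈ p * a
    split = ≈-trans
      (solve 4 (λ p ε nε a → p :* ε :* a :+ p :* ((con 1 :+ nε) :* a)
                          := p :* ((con 1 :+ (ε :+ nε)) :* a)) ≈-refl p ε (- ε) a)
      (*-congˡ (≈-trans (*-congʳ (≈-trans (+-congˡ (-‿inverseʳ ε)) (+-identityʳ 1#))) (*-identityˡ a)))

  ⁻¹≤1⇒1≤ : ∀ {ε} → 0# < ε → ε ⁻¹ ≤ 1# → 1# ≤ ε
  ⁻¹≤1⇒1≤ {ε} (0≤ε , 0≉ε) ε⁻¹≤1 = begin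
    1#        ≈⟨ *-inverseʳ (0≉ε ∘ ≈-sym) ⟨
    ε * ε ⁻¹  ≤⟨ *-monoˡ-≤ 0≤ε ε⁻¹≤1 ⟩
    ε * 1#    ≈⟨ *-identityʳ ε ⟩
    ε         ∎
    where open ≤-Reasoning

-- Unions, insertions and cardinalities of finite subsets.

module _ {n : ℕ} where
  open ICMSolver (∪-idempotentCommutativeMonoid n) using (solve; _⊜_; _⊕_)

  ∪-insertˡ : ∀ (A B : Subset n) u → (A ∪ B) ∪ ⁅ u ⁆ ≡ (A ∪ ⁅ u ⁆) ∪ B
  ∪-insertˡ A B u = solve 3 (λ a b u → (a ⊕ b) ⊕ u ⊜ (a ⊕ u) ⊕ b) refl A B ⁅ u ⁆

∪-⊆ : ∀ {n} {A B C : Subset n} → A ⊆ C → B ⊆ C → A ∪ B ⊆ C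
∪-⊆ {A = A} {B} A⊆C B⊆C = [ A⊆C , B⊆C ]′ ∘ x∈p∪q⁻ A B

∪-monoʳ-⊆ : ∀ {n} (S : Subset n) {A B} → A ⊆ B → S ∪ A ⊆ S ∪ B
∪-monoʳ-⊆ S {A} {B} A⊆B = ∪-⊆ (p⊆p∪q B) (q⊆p∪q S B ∘ A⊆B)

∪-absorb-∈ : ∀ {n} {A : Subset n} {u} → u ∈ A → A ∪ ⁅ u ⁆ ≡ A
∪-absorb-∈ {A = A} {u} u∈A =
  ⊆-antisym (∪-⊆ ⊆-refl (λ x∈u → subst (_∈ A) (≡.sym (x∈⁅y⁆⇒x≡y u x∈u)) u∈A)) (p⊆p∪q ⁅ u ⁆)

remove-insert : ∀ {n} {A : Subset n} {u} → u ∈ A → (A ∖ u) ∪ ⁅ u ⁆ ≡ A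
remove-insert {n} {A} {u} u∈A = ⊆-antisym
  (∪-⊆ (p─q⊆p A ⁅ u ⁆) (λ x∈u → subst (_∈ A) (≡.sym (x∈⁅y⁆⇒x≡y u x∈u)) u∈A))
  A⊆
  where
  A⊆ : A ⊆ (A ∖ u) ∪ ⁅ u ⁆
  A⊆ {x} x∈A with x Fin.≟ u
  ... | yes refl = q⊆p∪q (A ∖ u) ⁅ u ⁆ (x∈⁅x⁆ u)
  ... | no x≢u   = p⊆p∪q ⁅ u ⁆ (x∈p∧x≢y⇒x∈p-y x∈A x≢u)

∣insert∣ : ∀ {n} {A : Subset n} {u} → u ∉ A → ∣ A ∪ ⁅ u ⁆ ∣ ≡ suc ∣ A ∣
∣insert∣ {A = true  ∷ A} {zero}  u∉A = contradiction here u∉A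
∣insert∣ {A = false ∷ A} {zero}  u∉A = cong (suc ∘ ∣_∣) (∪-identityʳ A)
∣insert∣ {A = true  ∷ A} {suc u} u∉A = cong suc (∣insert∣ (u∉A ∘ there))
∣insert∣ {A = false ∷ A} {suc u} u∉A = ∣insert∣ (u∉A ∘ there)

∣A∣≤0⇒A≡⊥ : ∀ {n} {A : Subset n} → ∣ A ∣ ℕ.≤ 0 → A ≡ ⊥
∣A∣≤0⇒A≡⊥ {A = []}        _ = refl
∣A∣≤0⇒A≡⊥ {A = false ∷ A} p = cong (false ∷_) (∣A∣≤0⇒A≡⊥ p)

-- The value guarantee of iterative greedy.

module _ {c ℓ} (ℛ : RealNumbers c ℓ) (I : Instance ℛ) where
  open RealNumbers ℛ renaming (refl to ≈-refl; sym to ≈-sym; trans to ≈-trans)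
  open RealProperties ℛ
  open Instance I
  open SemiringSolver commutativeSemiring using (solve; _:+_; _:*_; _:=_)

  -- Submodularity without subtraction, extended to u ∈ Y: there the marginal at `Y` vanishes and
  -- monotonicity suffices.
  diminishing : ∀ {X Y} u → X ⊆ Y → f (Y ∪ ⁅ u ⁆) + f X ≤ f (X ∪ ⁅ u ⁆) + f Y
  diminishing {X} {Y} u X⊆Y with u ∈? Y
  ... | no u∉Y  = -≤-⇒+≤+ (submodular X Y u X⊆Y u∉Y)
  ... | yes u∈Y = begin
    f (Y ∪ ⁅ u ⁆) + f X   ≈⟨ +-congʳ (reflexive (cong f (∪-absorb-∈ u∈Y))) ⟩
    f Y + f X             ≤⟨ +-monoʳ-≤ (f Y) (monotone X _ (p⊆p∪q ⁅ u ⁆)) ⟩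
    f Y + f (X ∪ ⁅ u ⁆)   ≈⟨ +-comm _ _ ⟩
    f (X ∪ ⁅ u ⁆) + f Y   ∎
    where open ≤-Reasoning

  GreedyRun-independent : ∀ {g A} → GreedyRun ℛ I g A → Independent A
  GreedyRun-independent start                 = ⊥-indep
  GreedyRun-independent (extend _ _ _ ind _)  = ind

  module _ (S : Subset n) where
    private
      h : Subset n → Carrier
      h A = f (S ∪ A)

      h-mono : ∀ {A B} → A ⊆ B → h A ≤ h B
      h-mono A⊆B = monotone _ _ (∪-monoʳ-⊆ S A⊆B)

      h-diminishing : ∀ {X Y} u → X ⊆ Y → h (Y ∪ ⁅ u ⁆) + h X ≤ h (X ∪ ⁅ u ⁆) + h Y
      h-diminishing {X} {Y} u X⊆Y = begin
        f (S ∪ (Y ∪ ⁅ u ⁆)) + f (S ∪ X)   ≈⟨ +-congʳ (reflexive (cong f (∪-assoc S Y ⁅ u ⁆))) ⟨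
        f ((S ∪ Y) ∪ ⁅ u ⁆) + f (S ∪ X)   ≤⟨ diminishing u (∪-monoʳ-⊆ S X⊆Y) ⟩
        f ((S ∪ X) ∪ ⁅ u ⁆) + f (S ∪ Y)   ≈⟨ +-congʳ (reflexive (cong f (∪-assoc S X ⁅ u ⁆))) ⟩
        f (S ∪ (X ∪ ⁅ u ⁆)) + f (S ∪ Y)   ∎
        where open ≤-Reasoning

    -- If O outgrows the greedy set A, an element o of O could have been chosen
    -- instead of u; the bound for O without o then gives the one for O.
    greedy-half : ∀ {A} → GreedyRun ℛ I (λ B → f (S ∪ B) - f S) A →
      ∀ O → Independent O → ∣ O ∣ ℕ.≤ ∣ A ∣ → h (A ∪ O) + h ⊥ ≤ h A + h A
    greedy-half start O _ ∣O∣≤∣⊥∣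
      rewrite ∣A∣≤0⇒A≡⊥ {A = O} (subst (∣ O ∣ ℕ.≤_) (∣⊥∣≡0 n) ∣O∣≤∣⊥∣) | ∪-identityʳ {n} ⊥ = ≤-refl
    greedy-half (extend {A} u run u∉A indep-Au u-best) O indep-O ∣O∣≤∣Au∣
      with ∣ O ∣ ℕₚ.≤? ∣ A ∣
    -- Three inequalities are added: the marginal of `u` over A ∪ O is at most that over A, the
    -- induction hypothesis, and h(A) ≤ h(Au).
    ... | yes ∣O∣≤∣A∣ =
      ≤-from-sum (h A + h A + h (A ∪ O))
        (solve 4 (λ a ao auo e → a :+ a :+ ao :+ (auo :+ e) := (auo :+ a) :+ (ao :+ e) :+ a)
          ≈-refl (h A) (h (A ∪ O)) (h (Au ∪ O)) (h ⊥))
        (solve 3 (λ a ao au → (au :+ ao) :+ (a :+ a) :+ au := a :+ a :+ ao :+ (au :+ au))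
          ≈-refl (h A) (h (A ∪ O)) (h Au))
        (+-mono-≤ (+-mono-≤ u-diminishing (greedy-half run O indep-O ∣O∣≤∣A∣)) (h-mono (p⊆p∪q ⁅ u ⁆)))
      where
      Au = A ∪ ⁅ u ⁆
      u-diminishing : h (Au ∪ O) + h A ≤ h Au + h (A ∪ O)
      u-diminishing = subst (λ X → h X + h A ≤ h Au + h (A ∪ O)) (∪-insertˡ A O u)
        (h-diminishing u (p⊆p∪q O))
    ... | no ∣O∣≰∣A∣
      with o , o∈O , o∉A , indep-Ao ← augmentation (GreedyRun-independent run) indep-O (ℕₚ.≰⇒> ∣O∣≰∣A∣)
      -- Five inequalities are added and everything common to both sides cancels: `o` gains no more
      -- over Au ∪ O′ than over Au, `u` no more over A ∪ O′ than over A, `o` no more over Au than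
      -- over A; then the induction hypothesis for O′, and h(Ao) ≤ h(Au) by the greedy choice.
      = ≤-from-sum (h Au + (h (Au ∪ O′) + h A) + (h Auo + h A) + h (A ∪ O′) + h Ao)
          (solve 8 (λ a au ao auo ao′ auo′ auO e →
            (au :+ (auo′ :+ a) :+ (auo :+ a) :+ ao′ :+ ao) :+ (auO :+ e) :=
            (auO :+ au) :+ (auo′ :+ a) :+ (auo :+ a) :+ (ao′ :+ e) :+ ao)
            ≈-refl (h A) (h Au) (h Ao) (h Auo) (h (A ∪ O′)) (h (Au ∪ O′)) (h (Au ∪ O)) (h ⊥))
          (solve 6 (λ a au ao auo ao′ auo′ →
            (auo :+ auo′) :+ (au :+ ao′) :+ (ao :+ au) :+ (a :+ a) :+ au :=
            (au :+ (auo′ :+ a) :+ (auo :+ a) :+ ao′ :+ ao) :+ (au :+ au))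
            ≈-refl (h A) (h Au) (h Ao) (h Auo) (h (A ∪ O′)) (h (Au ∪ O′)))
          (+-mono-≤ (+-mono-≤ (+-mono-≤ (+-mono-≤ o-after-O′ u-diminishing) (h-diminishing o (p⊆p∪q ⁅ u ⁆)))
            (greedy-half run O′ (hereditary (p─q⊆p O ⁅ o ⁆) indep-O) ∣O′∣≤∣A∣)) o≤u)
      where
      Au  = A ∪ ⁅ u ⁆
      Ao  = A ∪ ⁅ o ⁆
      Auo = Au ∪ ⁅ o ⁆
      O′  = O ∖ o
      ∣O′∣≤∣A∣ : ∣ O′ ∣ ℕ.≤ ∣ A ∣
      ∣O′∣≤∣A∣ = ℕₚ.≤-pred (ℕₚ.≤-trans (x∈p⇒∣p-x∣<∣p∣ o∈O) (subst (∣ O ∣ ℕ.≤_) (∣insert∣ u∉A) ∣O∣≤∣Au∣))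
      o-after-O′ : h (Au ∪ O) + h Au ≤ h Auo + h (Au ∪ O′)
      o-after-O′ = subst (λ X → h X + h Au ≤ h Auo + h (Au ∪ O′))
        (≡.trans (∪-assoc Au O′ ⁅ o ⁆) (cong (Au ∪_) (remove-insert o∈O)))
        (h-diminishing o (p⊆p∪q O′))
      u-diminishing : h (Au ∪ O′) + h A ≤ h Au + h (A ∪ O′)
      u-diminishing = subst (λ X → h X + h A ≤ h Au + h (A ∪ O′)) (∪-insertˡ A O′ u)
        (h-diminishing u (p⊆p∪q O′))
      o≤u : h Ao ≤ h Au
      o≤u = ≤-from-sum (- f S) (+-comm _ _) (+-comm _ _) (u-best o o∉A indep-Ao)

  -- A larger independent set would augment `A`, against its maximality. This supplies the
  -- cardinality hypothesis of `greedy-half`.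
  GreedyOutput-maximum : ∀ {g A} → GreedyOutput ℛ I g A → ∀ O → Independent O → ∣ O ∣ ℕ.≤ ∣ A ∣
  GreedyOutput-maximum {A = A} (run , maximal) O indep-O with ∣ O ∣ ℕₚ.≤? ∣ A ∣
  ... | yes ∣O∣≤∣A∣ = ∣O∣≤∣A∣
  ... | no ∣O∣≰∣A∣ with o , _ , o∉A , indep-Ao ← augmentation (GreedyRun-independent run) indep-O (ℕₚ.≰⇒> ∣O∣≰∣A∣)
    = contradiction indep-Ao (maximal o o∉A)

  -- This is f(O) - f(S) ≤ 2⁻ᵏ f(O), multiplied out to avoid division and subtraction. The base case
  -- is f(⊥) ≥ 0; each round contributes the inequality `half`.
  iterative-greedy-bound : ∀ {k S} → IterativeGreedyOutput ℛ I k S → ∀ O → Independent O →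
    fromℕ 2 ^ k * f O ≤ fromℕ 2 ^ k * f S + f O
  iterative-greedy-bound done O _ = begin
    1# * f O                ≈⟨ *-identityˡ (f O) ⟩
    f O                     ≈⟨ +-identityˡ (f O) ⟨
    0# + f O                ≤⟨ +-mono-≤ (nonNegative ⊥) ≤-refl ⟩
    f ⊥ + f O               ≈⟨ +-congʳ (*-identityˡ (f ⊥)) ⟨
    1# * f ⊥ + f O          ∎
    where open ≤-Reasoning
  iterative-greedy-bound (round {k} {S} {A} rounds greedy) O indep-O = begin
    fromℕ 2 ^ suc k * f O                     ≈⟨ 2^-suc-* k (f O) ⟩
    p * (f O + f O)                           ≈⟨ distribˡ p (f O) (f O) ⟩
    p * f O + p * f O                         ≤⟨ +-monoʳ-≤ (p * f O) (iterative-greedy-bound rounds O indep-O) ⟩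
    p * f O + (p * f S + f O)                 ≈⟨ solve 3 (λ p o s → p :* o :+ (p :* s :+ o) := p :* (o :+ s) :+ o) ≈-refl p (f O) (f S) ⟩
    p * (f O + f S) + f O                     ≤⟨ +-mono-≤ (*-monoˡ-≤ (≤-trans 0≤1 (1≤2^ k)) half) ≤-refl ⟩
    p * (f (S ∪ A) + f (S ∪ A)) + f O         ≈⟨ +-congʳ (2^-suc-* k (f (S ∪ A))) ⟨
    fromℕ 2 ^ suc k * f (S ∪ A) + f O         ∎
    where
    open ≤-Reasoning
    p = fromℕ 2 ^ k
    half : f O + f S ≤ f (S ∪ A) + f (S ∪ A)
    half = begin
      f O + f S                         ≤⟨ +-mono-≤ (monotone _ _ (⊆-trans (q⊆p∪q A O) (q⊆p∪q S _))) (monotone _ _ (p⊆p∪q ⊥)) ⟩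
      f (S ∪ (A ∪ O)) + f (S ∪ ⊥)       ≤⟨ greedy-half S (proj₁ greedy) O indep-O (GreedyOutput-maximum greedy O indep-O) ⟩
      f (S ∪ A) + f (S ∪ A)             ∎

  -- Membership in the matroid polytope.

  private module ∑ = SemiringSum semiring

  -- S ∪ A is the disjoint union of A ─ S and S, so indicators add.
  𝟏-∪ : ∀ (S A : Subset n) e → 𝟏 ℛ (S ∪ A) e ≈ 𝟏 ℛ (A ─ S) e + 𝟏 ℛ S e
  𝟏-∪ = go
    where
    -- The recursion shortens the vectors, so the length must vary; the outer `n` is fixed by the
    -- instance.
    go : ∀ {n} (S A : Subset n) e → 𝟏 ℛ (S ∪ A) e ≈ 𝟏 ℛ (A ─ S) e + 𝟏 ℛ S e
    go (true  ∷ S) (_     ∷ A) zero    = ≈-sym (+-identityˡ 1#)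
    go (false ∷ S) (true  ∷ A) zero    = ≈-sym (+-identityʳ 1#)
    go (false ∷ S) (false ∷ A) zero    = ≈-sym (+-identityʳ 0#)
    go (_     ∷ S) (_     ∷ A) (suc e) = go S A e

  𝟏-⊥ : ∀ {n} (e : Fin n) → 𝟏 ℛ ⊥ e ≈ 0#
  𝟏-⊥ zero    = ≈-refl
  𝟏-⊥ (suc e) = 𝟏-⊥ e

  independent-decomposition : ∀ {k S} → IterativeGreedyOutput ℛ I k S →
    ∃[ B ] (∀ (i : Fin k) → Independent (B i)) × (∀ e → 𝟏 ℛ S e ≈ sum (λ i → 𝟏 ℛ (B i) e))
  independent-decomposition done = (λ ()) , (λ ()) , 𝟏-⊥
  independent-decomposition (round {S = S} {A} rounds (run , _))
    with B , indep-B , S≈∑B ← independent-decomposition rounds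
    = (A ─ S) Vector.∷ B
    , (λ { zero → hereditary (p─q⊆p A S) (GreedyRun-independent run) ; (suc i) → indep-B i })
    , (λ e → ≈-trans (𝟏-∪ S A e) (+-congˡ (S≈∑B e)))

  -- The k + 1 independent pieces are averaged with equal weights. Having at least one round makes
  -- the number of pieces invertible.
  iterative-greedy-feasible : ∀ {k S} → IterativeGreedyOutput ℛ I (suc k) S →
    MatroidPolytope ℛ matroid (λ e → 𝟏 ℛ S e * fromℕ (suc k) ⁻¹)
  iterative-greedy-feasible {k} {S} output
    with B , indep-B , S≈∑B ← independent-decomposition output
    = suc k , (λ _ → w) , (λ i → 𝟏 ℛ (B i))
    , (λ _ → ⁻¹-nonNegative (fromℕ-nonNegative (suc k)) (1≤⇒≉0 (1≤fromℕ-suc k)))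
    , ∑w≈1 , (λ i → B i , indep-B i , λ _ → ≈-refl)
    , (λ e → ≈-trans (*-comm _ w) (≈-trans (*-congˡ (S≈∑B e)) (∑.*-distribˡ-sum w (λ i → 𝟏 ℛ (B i) e))))
    where
    w = fromℕ (suc k) ⁻¹
    ∑w≈1 : sum {suc k} (λ _ → w) ≈ 1#
    ∑w≈1 = begin
      sum {suc k} (λ _ → w)         ≈⟨ ∑.sum-replicate (suc k) ⟩
      suc k · w                     ≈⟨ SemiringMult.×-congʳ semiring (suc k) (*-identityˡ w) ⟨
      suc k · (1# * w)              ≈⟨ SemiringMult.×-assoc-* semiring (suc k) 1# w ⟨
      fromℕ (suc k) * w             ≈⟨ *-inverseʳ (1≤⇒≉0 (1≤fromℕ-suc k)) ⟩
      1#                            ∎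
      where open SetoidReasoning setoid

  iterative-greedy-bicriteria : ∀ {k S ε} → 0# < ε → ε < 1# → ε ⁻¹ ≤ fromℕ 2 ^ k →
    IterativeGreedyOutput ℛ I k S → IsBicriteriaApproximation ℛ I (1# - ε) (fromℕ k) S
  -- Zero rounds are impossible: ε⁻¹ ≤ 2⁰ would force 1 ≤ ε.
  iterative-greedy-bicriteria {zero} 0<ε (ε≤1 , ε≉1) ε⁻¹≤1 _ =
    contradiction (antisym ε≤1 (⁻¹≤1⇒1≤ 0<ε ε⁻¹≤1)) ε≉1
  iterative-greedy-bicriteria {suc k} 0<ε _ ε⁻¹≤2^k output =
    (λ O (indep-O , _) → geometric-decay (suc k) 0<ε ε⁻¹≤2^k (nonNegative O)
      (iterative-greedy-bound output O indep-O)) ,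
    iterative-greedy-feasible output

-- Bit array operations as operations on subsets.

<⇒∃toℕ : ∀ {n j} → j ℕ.< n → ∃[ u ] j ≡ toℕ {n} u
<⇒∃toℕ j<n = fromℕ< j<n , ≡.sym (Fin.toℕ-fromℕ< j<n)

getBit-lookup : ∀ {n} (A : Subset n) u → getBit (toℕ u) A ≡ lookup A u
getBit-lookup (_ ∷ A) zero    = refl
getBit-lookup (_ ∷ A) (suc u) = getBit-lookup A u

getBit⇒∈ : ∀ {n} {A : Subset n} {u} → getBit (toℕ u) A ≡ true → u ∈ A
getBit⇒∈ {A = A} {u} bit = lookup⇒[]= u A (≡.trans (≡.sym (getBit-lookup A u)) bit)

getBit⇒∉ : ∀ {n} {A : Subset n} {u} → getBit (toℕ u) A ≡ false → u ∉ A
getBit⇒∉ {A = A} {u} bit u∈A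
  with () ← ≡.trans (≡.sym bit) (≡.trans (getBit-lookup A u) ([]=⇒lookup u∈A))

setBit-inside : ∀ {n} (A : Subset n) u → setBit inside (toℕ u) A ≡ A ∪ ⁅ u ⁆
setBit-inside (true  ∷ A) zero    = cong (true ∷_) (≡.sym (∪-identityʳ A))
setBit-inside (false ∷ A) zero    = cong (true ∷_) (≡.sym (∪-identityʳ A))
setBit-inside (true  ∷ A) (suc u) = cong (true ∷_) (setBit-inside A u)
setBit-inside (false ∷ A) (suc u) = cong (false ∷_) (setBit-inside A u)

-- A removal undoes an insertion only when the element was absent before, which is why the program
-- tests membership before each trial insertion.
setBit-outside : ∀ {n} {A : Subset n} {u} → u ∉ A → setBit outside (toℕ u) (A ∪ ⁅ u ⁆) ≡ A
setBit-outside {A = true  ∷ A} {zero}  u∉A = contradiction here u∉A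
setBit-outside {A = false ∷ A} {zero}  u∉A = cong (false ∷_) (∪-identityʳ A)
setBit-outside {A = true  ∷ A} {suc u} u∉A = cong (true ∷_) (setBit-outside (u∉A ∘ there))
setBit-outside {A = false ∷ A} {suc u} u∉A = cong (false ∷_) (setBit-outside (u∉A ∘ there))

setBit-beyond : ∀ {n} b (A : Subset n) → setBit b n A ≡ A
setBit-beyond b []      = refl
setBit-beyond b (a ∷ A) = cong (a ∷_) (setBit-beyond b A)

-- The algorithm as an oracle program.

pattern ground    = 0
pattern iteration = 1
pattern candidate = 2
pattern best      = 3

pattern bestValue    = 0
pattern currentValue = 1

-- `union` is 0 because the output is read from set register 0. The three sorts of registers have
-- separate name spaces, so numbers may repeat.
pattern union  = 0
pattern greedy = 1

queryCandidate : Program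
queryCandidate =
  ifte (member candidate union)
    (exec (query currentValue union))
    (exec (insert union candidate) ⨾ exec (query currentValue union) ⨾ exec (remove union candidate))

-- The comparison is non-strict so that even a first candidate of value 0 replaces the initial
-- `bestValue`.
updateBest : Program
updateBest =
  ifte (le-val bestValue currentValue)
    (exec (copy-val bestValue currentValue) ⨾ exec (copy-ctr best candidate))
    skip

tryCandidate : Program
tryCandidate =
  ifte (member candidate greedy)
    skip
    (exec (insert greedy candidate)
      ⨾ ifte (indep greedy) (queryCandidate ⨾ updateBest) skip
      ⨾ exec (remove greedy candidate))

-- Initially best = n lies outside the bit arrays, so that inserting it has no
-- effect, and bestValue = 0 is beaten by every candidate since f ≥ 0.
scan : Program
scan = exec (zero-ctr candidate) ⨾ exec (copy-ctr best ground) ⨾ exec (sub-val bestValue bestValue bestValue)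
  ⨾ while (lt-ctr candidate ground) (tryCandidate ⨾ exec (inc-ctr candidate))

greedyStep : Program
greedyStep = scan ⨾ exec (insert union best) ⨾ exec (insert greedy best) ⨾ exec (inc-ctr iteration)

-- The loop always makes n iterations; once the greedy set is maximal, the remaining ones change
-- neither set.
greedyRound : Program
greedyRound = exec (zero-ctr iteration) ⨾ exec (clear-set greedy)
  ⨾ while (lt-ctr iteration ground) greedyStep

-- The rounds are unrolled into the syntax: `k` is a constant of the program, independent of the
-- instance. The base case loads n into `ground` for all rounds.
iterativeGreedy : ℕ → Program
iterativeGreedy zero    = exec (size ground)
iterativeGreedy (suc k) = iterativeGreedy k ⨾ greedyRound

-- Total correctness with step bounds.

⌊⌋≡true⇒ : ∀ {p} {P : Set p} (P? : Dec P) → ⌊ P? ⌋ ≡ true → P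
⌊⌋≡true⇒ (yes p) _ = p

⌊⌋≡false⇒¬ : ∀ {p} {P : Set p} (P? : Dec P) → ⌊ P? ⌋ ≡ false → ¬ P
⌊⌋≡false⇒¬ (no ¬p) _ = ¬p

module _ {c ℓ} (ℛ : RealNumbers c ℓ) (I : Instance ℛ) where
  open RealNumbers ℛ renaming (refl to ≈-refl; sym to ≈-sym; trans to ≈-trans)
  open RealProperties ℛ
  open Instance I
  open State

  -- A total-correctness Hoare judgement with a cost bound `b` instead of an exact step count, so
  -- that branches of different lengths can be treated together.
  Runs : ∀ {p} → Program → State ℛ n → ℕ → (State ℛ n → Set p) → Set (c ⊔ p)
  Runs P σ b Q = ∃[ t ] ∃[ τ ] ⟨_,_⟩⇓[_]_ ℛ I P σ t τ × t ℕ.≤ b × Q τ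

  private variable
    p q : Level
    P R : Program
    b d : ℕ
    σ : State ℛ n
    Q : State ℛ n → Set p
    i : Instruction
    test : Test

  runs-skip : Q σ → Runs skip σ 0 Q
  runs-skip Qσ = 0 , _ , skip , z≤n , Qσ

  runs-exec : Q (execute ℛ I i σ) → Runs (exec i) σ 1 Q
  runs-exec Qσ = 1 , _ , exec , s≤s z≤n , Qσ

  runs-⨾ : {Q : State ℛ n → Set p} {Q′ : State ℛ n → Set q} →
    Runs P σ b Q → (∀ {τ} → Q τ → Runs R τ d Q′) → Runs (P ⨾ R) σ (b ℕ.+ d) Q′
  runs-⨾ (s , τ , P⇓ , s≤b , Qτ) R-runs with t , υ , R⇓ , t≤d , Q′υ ← R-runs Qτ =
    s ℕ.+ t , υ , P⇓ ⨾ R⇓ , ℕₚ.+-mono-≤ s≤b t≤d , Q′υ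

  runs-exec-⨾ : Runs R (execute ℛ I i σ) d Q → Runs (exec i ⨾ R) σ (suc d) Q
  runs-exec-⨾ (t , υ , R⇓ , t≤d , Qυ) = suc t , υ , exec ⨾ R⇓ , s≤s t≤d , Qυ

  -- Adding the two branch bounds replaces their maximum and keeps the cost a polynomial expression.
  runs-ifte : (evaluate ℛ I test σ ≡ true → Runs P σ b Q) → (evaluate ℛ I test σ ≡ false → Runs R σ d Q) →
    Runs (ifte test P R) σ (suc (b ℕ.+ d)) Q
  runs-ifte {test = test} {σ} {b = b} {d = d} P-runs R-runs with evaluate ℛ I test σ in eq
  ... | true  with t , τ , P⇓ , t≤b , Qτ ← P-runs refl =
    suc t , τ , if-true eq P⇓ , s≤s (ℕₚ.≤-trans t≤b (ℕₚ.m≤m+n b d)) , Qτ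
  ... | false with t , τ , R⇓ , t≤d , Qτ ← R-runs refl =
    suc t , τ , if-false eq R⇓ , s≤s (ℕₚ.≤-trans t≤d (ℕₚ.m≤n+m d b)) , Qτ

  -- Each iteration costs one test plus the body, and the final failing test costs 1. The invariant
  -- must determine both counters so that the guard can be evaluated.
  runs-for : ∀ {x} (Inv : ℕ → State ℛ n → Set p) →
    (∀ {j σ} → Inv j σ → ctr σ x ≡ j × ctr σ ground ≡ n) →
    (∀ {j σ} → j ℕ.< n → Inv j σ → Runs P σ b (Inv (suc j))) →
    ∀ {σ} → Inv 0 σ → Runs (while (lt-ctr x ground) P) σ (n ℕ.* suc b ℕ.+ 1) (Inv n)
  -- `go` recurses on the number m of iterations left, with m + j = n.
  runs-for {P = P} {b = b} {x = x} Inv counters body = go n 0 (ℕₚ.+-identityʳ n)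
    where
    j<n : ∀ {m j} → suc m ℕ.+ j ≡ n → j ℕ.< n
    j<n {m} {j} m+j≡n = subst (suc j ℕ.≤_) m+j≡n (s≤s (ℕₚ.m≤n+m j m))

    go : ∀ m j → m ℕ.+ j ≡ n → ∀ {σ} → Inv j σ →
      Runs (while (lt-ctr x ground) P) σ (m ℕ.* suc b ℕ.+ 1) (Inv n)
    go zero _ refl {σ} inv = 1 , σ , while-false test≡false , s≤s z≤n , inv
      where
      test≡false : (ctr σ x ℕ.<ᵇ ctr σ ground) ≡ false
      test≡false = ≡.trans (cong₂ ℕ._<ᵇ_ (proj₁ (counters inv)) (proj₂ (counters inv)))
        (dec-false (n ℕₚ.<? n) (ℕₚ.<-irrefl refl))
    go (suc m) j m+j≡n {σ} inv
      with s , τ , P⇓ , s≤b , inv′ ← body (j<n m+j≡n) inv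
      with t , υ , W⇓ , t≤ , invₙ ← go m (suc j) (≡.trans (ℕₚ.+-suc m j) m+j≡n) inv′
      = suc (s ℕ.+ t) , υ , while-true test≡true P⇓ W⇓
      , s≤s (ℕₚ.≤-trans (ℕₚ.+-mono-≤ s≤b t≤) (ℕₚ.≤-reflexive (≡.sym (ℕₚ.+-assoc b _ 1)))) , invₙ
      where
      test≡true : (ctr σ x ℕ.<ᵇ ctr σ ground) ≡ true
      test≡true = ≡.trans (cong₂ ℕ._<ᵇ_ (proj₁ (counters inv)) (proj₂ (counters inv)))
        (dec-true (j ℕₚ.<? n) (j<n m+j≡n))

  runs-weaken : {Q : State ℛ n → Set p} {Q′ : State ℛ n → Set q} → (∀ {τ} → Q τ → Q′ τ) →
    b ℕ.≤ d → Runs P σ b Q → Runs P σ d Q′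
  runs-weaken Q⇒Q′ b≤d (t , τ , P⇓ , t≤b , Qτ) = t , τ , P⇓ , ℕₚ.≤-trans t≤b b≤d , Q⇒Q′ Qτ

  -- One round of the program computes a greedy output.

  module _ (S : Subset n) where
    private
      h : Subset n → Carrier
      h A = f (S ∪ A)

    Candidate : Subset n → Fin n → Set
    Candidate A u = u ∉ A × Independent (A ∪ ⁅ u ⁆)

    -- The possible contents of best and bestValue once the elements below v are
    -- scanned; best = n means that no candidate was found.
    data BestBelow (A : Subset n) (v : ℕ) : ℕ → Carrier → Set (c ⊔ ℓ) where
      none : ∀ {x} → x ≈ 0# → (∀ w → toℕ w ℕ.< v → ¬ Candidate A w) → BestBelow A v n x
      some : ∀ u → Candidate A u →
        (∀ w → toℕ w ℕ.< v → Candidate A w → h (A ∪ ⁅ w ⁆) ≤ h (A ∪ ⁅ u ⁆)) →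
        BestBelow A v (toℕ u) (h (A ∪ ⁅ u ⁆))

    -- `G` is kept apart from `A` because the greedy register holds A ∪ ⁅ u ⁆ while candidate `u` is
    -- being tried.
    record Loaded (A G : Subset n) (i : ℕ) (σ : State ℛ n) : Set where
      constructor mkLoaded
      field
        ground≡    : ctr σ ground ≡ n
        iteration≡ : ctr σ iteration ≡ i
        union≡     : set σ union ≡ S ∪ A
        greedy≡    : set σ greedy ≡ G

    -- `m` is kept apart from `v` because, between an update and the increment of the counter, the
    -- elements below v + 1 are already accounted for.
    record Scanned (A G : Subset n) (i v m : ℕ) (σ : State ℛ n) : Set (c ⊔ ℓ) where
      constructor mkScanned
      field
        loaded     : Loaded A G i σ
        candidate≡ : ctr σ candidate ≡ v
        bestBelow  : BestBelow A m (ctr σ best) (val σ bestValue)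
    open Scanned

    below-suc : ∀ {p} (P : Fin n → Set p) {u} → P u → (∀ w → toℕ w ℕ.< toℕ u → P w) →
      ∀ w → toℕ w ℕ.< suc (toℕ u) → P w
    below-suc P Pu P< w w<1+u with ℕₚ.m≤n⇒m<n∨m≡n (ℕₚ.≤-pred w<1+u)
    ... | inj₁ w<u = P< w w<u
    ... | inj₂ w≡u = subst P (≡.sym (Fin.toℕ-injective w≡u)) Pu

    BestBelow-skip : ∀ {A u m x} → ¬ Candidate A u → BestBelow A (toℕ u) m x → BestBelow A (suc (toℕ u)) m x
    BestBelow-skip ¬cand (none x≈0 ¬cands)      = none x≈0 (below-suc _ ¬cand ¬cands)
    BestBelow-skip ¬cand (some v cand-v v-best) =
      some v cand-v (below-suc _ (λ cand → contradiction cand ¬cand) v-best)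

    BestBelow-update : ∀ {A u m x} → Candidate A u → x ≤ h (A ∪ ⁅ u ⁆) →
      BestBelow A (toℕ u) m x → BestBelow A (suc (toℕ u)) (toℕ u) (h (A ∪ ⁅ u ⁆))
    BestBelow-update cand x≤hu (none _ ¬cands) =
      some _ cand (below-suc _ (λ _ → ≤-refl) (λ w w<u cand-w → contradiction cand-w (¬cands w w<u)))
    BestBelow-update cand x≤hu (some v _ v-best) =
      some _ cand (below-suc _ (λ _ → ≤-refl) (λ w w<u cand-w → ≤-trans (v-best w w<u cand-w) x≤hu))

    BestBelow-keep : ∀ {A u m x} → Candidate A u → ¬ (x ≤ h (A ∪ ⁅ u ⁆)) →
      BestBelow A (toℕ u) m x → BestBelow A (suc (toℕ u)) m x
    BestBelow-keep cand x≰hu (none x≈0 _) =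
      -- With no candidate so far the stored value is 0, and a non-negative value cannot lose to it.
      contradiction (≤-trans (≤-reflexive x≈0) (nonNegative _)) x≰hu
    BestBelow-keep {A} {u} {x = x} cand x≰hu (some v cand-v v-best) =
      some v cand-v (below-suc _ (λ _ → [ id , (λ x≤hu → contradiction x≤hu x≰hu) ]′ (total _ _)) v-best)

    queryCandidate-runs : ∀ {A G i u m σ} → Scanned A G i (toℕ u) m σ →
      Runs queryCandidate σ 5 (λ τ → Scanned A G i (toℕ u) m τ × val τ currentValue ≡ h (A ∪ ⁅ u ⁆))
    queryCandidate-runs {A} {G} {i} {u} {m} {σ} (mkScanned (mkLoaded g≡ i≡ ∪≡ G≡) c≡ below) =
      runs-ifte {b = 1} {d = 3}
        -- If `u` already lies in S ∪ A, inserting it changes nothing, and the value of the current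
        -- union is the one sought.
        (λ bit → runs-exec (mkScanned (mkLoaded g≡ i≡ ∪≡ G≡) c≡ below ,
          cong f (≡.trans ∪≡ (≡.sym (≡.trans (≡.sym (∪-assoc S A ⁅ u ⁆)) (∪-absorb-∈ (getBit⇒∈ (bit′ bit))))))))
        (λ bit → runs-exec-⨾ (runs-exec-⨾ (runs-exec
          ( mkScanned (mkLoaded g≡ i≡ (≡.trans (cong₂ (setBit outside) c≡ inserted) (setBit-outside (getBit⇒∉ (bit′ bit)))) G≡) c≡ below
          , cong f (≡.trans inserted (∪-assoc S A ⁅ u ⁆))))))
      where
      bit′ : ∀ {b} → getBit (ctr σ candidate) (set σ union) ≡ b → getBit (toℕ u) (S ∪ A) ≡ b
      bit′ = ≡.trans (≡.sym (cong₂ getBit c≡ ∪≡))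
      inserted : setBit inside (ctr σ candidate) (set σ union) ≡ (S ∪ A) ∪ ⁅ u ⁆
      inserted = ≡.trans (cong₂ (setBit inside) c≡ ∪≡) (setBit-inside (S ∪ A) u)

    updateBest-runs : ∀ {A G i u σ} → Candidate A u → Scanned A G i (toℕ u) (toℕ u) σ →
      val σ currentValue ≡ h (A ∪ ⁅ u ⁆) →
      Runs updateBest σ 3 (Scanned A G i (toℕ u) (suc (toℕ u)))
    updateBest-runs {A} {G} {i} {u} {σ} cand (mkScanned (mkLoaded g≡ i≡ ∪≡ G≡) c≡ below) v≡ =
      runs-ifte {b = 2} {d = 0}
        (λ le → runs-exec-⨾ (runs-exec (mkScanned (mkLoaded g≡ i≡ ∪≡ G≡) c≡
          (≡.subst₂ (BestBelow A (suc (toℕ u))) (≡.sym c≡) (≡.sym v≡)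
            (BestBelow-update cand (subst (val σ bestValue ≤_) v≡ (⌊⌋≡true⇒ (_ ≤? _) le)) below)))))
        (λ le → runs-skip (mkScanned (mkLoaded g≡ i≡ ∪≡ G≡) c≡
          (BestBelow-keep cand (⌊⌋≡false⇒¬ (_ ≤? _) le ∘ subst (val σ bestValue ≤_) (≡.sym v≡)) below)))

    tryCandidate-runs : ∀ {A i u σ} → Scanned A A i (toℕ u) (toℕ u) σ →
      Runs tryCandidate σ 12 (Scanned A A i (toℕ u) (suc (toℕ u)))
    tryCandidate-runs {A} {i} {u} {σ} (mkScanned (mkLoaded g≡ i≡ ∪≡ G≡) c≡ below) =
      runs-ifte {b = 0} {d = 11}
        (λ bit → runs-skip (mkScanned (mkLoaded g≡ i≡ ∪≡ G≡) c≡
          (BestBelow-skip (λ (u∉A , _) → u∉A (getBit⇒∈ (bit′ bit))) below)))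
        (λ bit → runs-exec-⨾ (runs-⨾ {b = 9} {d = 1}
          (runs-ifte {b = 8} {d = 0}
            (λ ind → let cand = getBit⇒∉ (bit′ bit) , subst Independent inserted (⌊⌋≡true⇒ (independent? _) ind) in
              runs-⨾ {b = 5} {d = 3} (queryCandidate-runs after-insert)
                (λ (scanned , v≡) → updateBest-runs cand scanned v≡))
            (λ ind → runs-skip (mkScanned (loaded after-insert) c≡
              (BestBelow-skip (λ (_ , ind-Au) → ⌊⌋≡false⇒¬ (independent? _) ind (subst Independent (≡.sym inserted) ind-Au)) below))))
          (λ (mkScanned (mkLoaded g≡ i≡ ∪≡ G≡) c≡ below) → runs-exec (mkScanned
            (mkLoaded g≡ i≡ ∪≡ (≡.trans (cong₂ (setBit outside) c≡ G≡) (setBit-outside (getBit⇒∉ (bit′ bit))))) c≡ below))))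
      where
      bit′ : ∀ {b} → getBit (ctr σ candidate) (set σ greedy) ≡ b → getBit (toℕ u) A ≡ b
      bit′ = ≡.trans (≡.sym (cong₂ getBit c≡ G≡))
      inserted : setBit inside (ctr σ candidate) (set σ greedy) ≡ A ∪ ⁅ u ⁆
      inserted = ≡.trans (cong₂ (setBit inside) c≡ G≡) (setBit-inside A u)
      after-insert : Scanned A (A ∪ ⁅ u ⁆) i (toℕ u) (toℕ u) (execute ℛ I (insert greedy candidate) σ)
      after-insert = mkScanned (mkLoaded g≡ i≡ ∪≡ inserted) c≡ below

    scan-runs : ∀ {A i σ} → Loaded A A i σ → Runs scan σ (3 ℕ.+ (n ℕ.* 14 ℕ.+ 1)) (Scanned A A i n n)
    scan-runs {A} {i} {σ} (mkLoaded g≡ i≡ ∪≡ G≡) =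
      runs-exec-⨾ (runs-exec-⨾ (runs-exec-⨾ (runs-for (λ v → Scanned A A i v v)
        (λ (mkScanned (mkLoaded g≡ _ _ _) c≡ _) → c≡ , g≡) step
        (mkScanned (mkLoaded g≡ i≡ ∪≡ G≡) refl
          -- The language has no constant 0; subtracting the register from itself yields it up to
          -- `≈`.
          (subst (λ m → BestBelow A 0 m (val σ bestValue - val σ bestValue)) (≡.sym g≡) (none (-‿inverseʳ _) (λ _ ())))))))
      where
      step : ∀ {j σ} → j ℕ.< n → Scanned A A i j j σ →
        Runs (tryCandidate ⨾ exec (inc-ctr candidate)) σ 13 (Scanned A A i (suc j) (suc j))
      step j<n scanned with u , refl ← <⇒∃toℕ j<n =
        runs-⨾ {b = 12} (tryCandidate-runs scanned)
          (λ (mkScanned (mkLoaded g≡ i≡ ∪≡ G≡) c≡ below) →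
            runs-exec (mkScanned (mkLoaded g≡ i≡ ∪≡ G≡) (cong suc c≡) below))

    private
      g : Subset n → Carrier
      g B = f (S ∪ B) - f S

    Maximal : Subset n → Set
    Maximal A = ∀ v → v ∉ A → ¬ Independent (A ∪ ⁅ v ⁆)

    -- Another element would give a subset with more than n elements.
    n≤∣A∣⇒Maximal : ∀ {A} → n ℕ.≤ ∣ A ∣ → Maximal A
    n≤∣A∣⇒Maximal {A} n≤∣A∣ v v∉A _ =
      ℕₚ.<⇒≱ (ℕₚ.≤-trans (s≤s n≤∣A∣) (ℕₚ.≤-reflexive (≡.sym (∣insert∣ v∉A)))) (∣p∣≤n (A ∪ ⁅ v ⁆))

    -- Either every iteration so far enlarged the set or the set is already maximal. At i = n both
    -- alternatives give maximality.
    GreedyState : ℕ → State ℛ n → Set ℓ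
    GreedyState i σ = ∃[ A ] Loaded A A i σ × GreedyRun ℛ I g A × (i ℕ.≤ ∣ A ∣ ⊎ Maximal A)

    greedyStep-runs : ∀ {i σ} → GreedyState i σ →
      Runs greedyStep σ (3 ℕ.+ (n ℕ.* 14 ℕ.+ 1) ℕ.+ 3) (GreedyState (suc i))
    greedyStep-runs {i} (A , loaded , run , progress) = runs-⨾ {d = 3} (scan-runs loaded) insertBest
      where
      insertBest : ∀ {σ} → Scanned A A i n n σ →
        Runs (exec (insert union best) ⨾ exec (insert greedy best) ⨾ exec (inc-ctr iteration)) σ 3 (GreedyState (suc i))
      insertBest {σ} (mkScanned (mkLoaded g≡ i≡ ∪≡ G≡) _ below)
        -- Abstracting the two registers lets the indices of `BestBelow` unify; `b≡` retains what is
        -- inserted.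
        with ctr σ best in b≡ | val σ bestValue | below
      ... | _ | _ | none _ ¬cands = runs-exec-⨾ (runs-exec-⨾ (runs-exec
        ( A
        , mkLoaded g≡ (cong suc i≡) (≡.trans (cong₂ (setBit inside) b≡ ∪≡) (setBit-beyond _ _))
            (≡.trans (cong₂ (setBit inside) b≡ G≡) (setBit-beyond _ _))
        , run
        , inj₂ (λ v v∉A ind → ¬cands v (Fin.toℕ<n v) (v∉A , ind)))))
      ... | _ | _ | some u (u∉A , ind) u-best = runs-exec-⨾ (runs-exec-⨾ (runs-exec
        ( A ∪ ⁅ u ⁆
        , mkLoaded g≡ (cong suc i≡)
            (≡.trans (cong₂ (setBit inside) b≡ ∪≡) (≡.trans (setBit-inside _ u) (∪-assoc S A ⁅ u ⁆)))
            (≡.trans (cong₂ (setBit inside) b≡ G≡) (setBit-inside A u))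
        , extend u run u∉A ind (λ v v∉A ind-v → +-mono-≤ (u-best v (Fin.toℕ<n v) (v∉A , ind-v)) ≤-refl)
        -- As `u` is a candidate, `A` was not maximal, so i ≤ ∣ A ∣ and the insertion raises both
        -- sides by one.
        , inj₁ (subst (suc i ℕ.≤_) (≡.sym (∣insert∣ u∉A))
            (s≤s ([ id , (λ maximal → contradiction ind (maximal u u∉A)) ]′ progress))))))

    greedyRound-runs : ∀ {σ} → ctr σ ground ≡ n → set σ union ≡ S →
      Runs greedyRound σ (2 ℕ.+ (n ℕ.* suc (3 ℕ.+ (n ℕ.* 14 ℕ.+ 1) ℕ.+ 3) ℕ.+ 1))
        (λ τ → ctr τ ground ≡ n × ∃[ A ] set τ union ≡ S ∪ A × GreedyOutput ℛ I g A)
    greedyRound-runs g≡ ∪≡ = runs-weaken finish ℕₚ.≤-refl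
      (runs-exec-⨾ (runs-exec-⨾ (runs-for GreedyState
        (λ (_ , mkLoaded g≡ i≡ _ _ , _) → i≡ , g≡) (λ _ → greedyStep-runs)
        (⊥ , mkLoaded g≡ refl (≡.trans ∪≡ (≡.sym (∪-identityʳ S))) refl , start , inj₁ z≤n))))
      where
      finish : ∀ {τ} → GreedyState n τ → ctr τ ground ≡ n × ∃[ A ] set τ union ≡ S ∪ A × GreedyOutput ℛ I g A
      finish (A , mkLoaded g≡ _ ∪≡ _ , run , progress) =
        g≡ , A , ∪≡ , run , [ n≤∣A∣⇒Maximal , id ]′ progress

  -- The running time of all rounds, and the conclusion.

  round-cost-≤ : ∀ m → 2 ℕ.+ (m ℕ.* suc (3 ℕ.+ (m ℕ.* 14 ℕ.+ 1) ℕ.+ 3) ℕ.+ 1) ℕ.≤ 14 ℕ.* suc m ℕ.^ 2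
  round-cost-≤ m = subst (2 ℕ.+ (m ℕ.* suc (3 ℕ.+ (m ℕ.* 14 ℕ.+ 1) ℕ.+ 3) ℕ.+ 1) ℕ.≤_)
    (ℕSolver.solve 1 (λ m →
      (con 2 :+ (m :* (con 1 :+ (con 3 :+ (m :* con 14 :+ con 1) :+ con 3)) :+ con 1)) :+ (m :* con 20 :+ con 11)
      := con 14 :* ((con 1 :+ m) :* ((con 1 :+ m) :* con 1))) refl m)
    -- The round costs 14m² + 8m + 3, and 20m + 11 is what is missing to 14(m + 1)².
    (ℕₚ.m≤m+n _ (m ℕ.* 20 ℕ.+ 11))
    where open ℕSolver using (con; _:+_; _:*_; _:=_)

  -- In the coefficient 1 + 14k, the 1 pays for loading n and each round adds 14; the degree stays 2
  -- for every `k`.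
  iterativeGreedy-runs : ∀ k → Runs (iterativeGreedy k) (initial ℛ I) (suc (k ℕ.* 14) ℕ.* suc n ℕ.^ 2)
    (λ τ → ctr τ ground ≡ n × IterativeGreedyOutput ℛ I k (set τ union))
  iterativeGreedy-runs zero = runs-weaken id (ℕₚ.≤-trans (ℕₚ.m^n>0 (suc n) 2) (ℕₚ.m≤m+n _ 0))
    (runs-exec (refl , done))
  iterativeGreedy-runs (suc k) = runs-weaken id bound
    (runs-⨾ (iterativeGreedy-runs k) (λ {τ} (g≡ , output) →
      runs-weaken (λ (g≡′ , A , ∪≡ , greedyA) →
        g≡′ , subst (IterativeGreedyOutput ℛ I (suc k)) (≡.sym ∪≡) (round output greedyA))
        (round-cost-≤ n) (greedyRound-runs (set τ union) g≡ refl)))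
    where
    bound : suc (k ℕ.* 14) ℕ.* suc n ℕ.^ 2 ℕ.+ 14 ℕ.* suc n ℕ.^ 2 ℕ.≤ suc (suc k ℕ.* 14) ℕ.* suc n ℕ.^ 2
    bound = ℕₚ.≤-reflexive (≡.trans (≡.sym (ℕₚ.*-distribʳ-+ (suc n ℕ.^ 2) (suc (k ℕ.* 14)) 14))
      (cong (ℕ._* suc n ℕ.^ 2) (cong suc (ℕₚ.+-comm (k ℕ.* 14) 14))))

  -- One run provides both the time bound and the greedy structure of the output, from which all
  -- three claims about the program follow.
  iterativeGreedy-halts : ∀ k → ∃[ t ] ∃[ S ] HaltsWith ℛ I (iterativeGreedy k) t S ×
    t ℕ.≤ suc (k ℕ.* 14) ℕ.* suc n ℕ.^ 2 × IterativeGreedyOutput ℛ I k S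
  iterativeGreedy-halts k with t , τ , P⇓ , t≤ , _ , output ← iterativeGreedy-runs k =
    t , set τ union , (τ , P⇓ , refl) , t≤ , output

theorem4p35 : ∀ {c ℓ : Level} (ℛ : RealNumbers c ℓ) →
    let open RealNumbers ℛ in
    (ε : Carrier) → 0# < ε → ε < 1# →
    (L : Carrier) (k : ℕ) → IsLog₂ (ε ⁻¹) L → IsCeiling L k →
    ∃[ P ] PolynomialTime ℛ P
    × BicriteriaApproximationAlgorithm ℛ (1# - ε) (fromℕ k) P
    × IterativeGreedyAlgorithm ℛ k P
theorem4p35 ℛ ε 0<ε ε<1 L k log (L≤k , _) =
  iterativeGreedy k
  , (suc (k ℕ.* 14) , 2 , λ I →
      let t , S , halts , t≤ , _ = iterativeGreedy-halts ℛ I k in t , S , halts , t≤)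
  , (λ I → let t , S , halts , _ , output = iterativeGreedy-halts ℛ I k in
      t , S , halts , iterative-greedy-bicriteria ℛ I 0<ε ε<1 ε⁻¹≤2^k output)
  , (λ I → let t , S , halts , _ , output = iterativeGreedy-halts ℛ I k in t , S , halts , output)
  where
  ε⁻¹≤2^k = RealProperties.log₂≤⇒≤2^ ℛ k log L≤k
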